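{- For every positive integer $n$ and every simple hypergraph $H=([n],E)$ all of whose edges are nonempty, $$\bigl|\operatorname{vert}P_{\mathrm{fpm}}(H)\bigr|\leq B_n .$$ As a consequence, $\bigl|\operatorname{vert}P_{\mathrm{fpm}}(H)\bigr|=O\!\left(2^{n^2-n}/n!\right)$ as $n\to\infty$, uniformly in $H$ (that is, the implied constant does not depend on $H$).
   Context: A simple hypergraph $H=([n],E)$ has vertex set $[n]=\{1,\dots,n\}$ and a set $E\subseteq 2^{[n]}$ of (distinct) edges. Its incidence matrix $A_H\in\{0,1\}^{[n]\times E}$ has $(A_H)_{i,e}=1$ if $i\in e$ and $0$ otherwise. The fractional perfect-matching polytope of $H$ is $P_{\mathrm{fpm}}(H):=\{x\in\mathbb{R}_{\ge 0}^{E}: A_Hx=\mathbf{1}\}$, where $\mathbf{1}=(1,\dots,1)^{\mathsf T}\in\mathbb{R}^n$, and $\operatorname{vert}P$ denotes the set of vertices (extreme points) of a polytope $P$. A collection $\Phi\subseteq 2^{[n]}$ is balanced if there exist positive real weights $(\lambda_S)_{S\in\Phi}$ with $\sum_{S\in\Phi}\lambda_S\mathbf{1}_S=\mathbf{1}$, where $\mathbf{1}_S$ is the characteristic vector of $S$. A balanced collection is minimal if none of its proper subcollections is balanced. $B_n$ is the number of minimal balanced collections on $[n]$. -}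

module Defs where

open import Algebra.Bundles using (CommutativeRing)
import Algebra.Properties.Semiring.Sum as SemiringSum
open import Data.Bool using (if_then_else_)
open import Data.Fin using (Fin)
open import Data.Fin.Subset using (Subset; Nonempty)
open import Data.Fin.Subset.Properties using (_∈?_)
open import Data.Nat using (ℕ; _!)
open import Data.Nat.Properties using (_!≢0)
open import Data.Integer using (+_)
open import Data.Product using (Σ; ∃; _×_; _,_; proj₁)
import Data.Rational as ℚ
open import Data.Vec.Functional using (Vector)
import Data.Vec.Functional.Relation.Binary.Equality.Setoid as VecEq
open import Function using (_∘_)
open import Function.Bundles using (Bijection)
open import Function.Definitions using (Injective)
open import Level using (0ℓ) renaming (suc to lsuc)
open import Relation.Binary.Bundles using (Setoid)
import Relation.Binary.Construct.NonStrictToStrict as Strict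
import Relation.Binary.Construct.On as On
open import Relation.Binary.Core using (Rel)
open import Relation.Binary.PropositionalEquality using (_≡_; setoid)
open import Relation.Binary.Structures using (IsTotalOrder)
open import Relation.Nullary using (¬_; does)
open import Relation.Unary using (Pred)

-- The classical axioms of the real numbers: a Dedekind-complete ordered field.
-- They determine ℝ up to unique isomorphism.
record RealNumbers : Set₁ where
  field
    commutativeRing : CommutativeRing 0ℓ 0ℓ

  open CommutativeRing commutativeRing public
    renaming (setoid to ℝ-setoid)

  infix 4 _≤_
  field
    _≤_          : Rel Carrier 0ℓ
    isTotalOrder : IsTotalOrder _≈_ _≤_
    0≉1          : ¬ 0# ≈ 1#
    inverse      : ∀ x → ¬ x ≈ 0# → ∃ λ y → x * y ≈ 1#
    +-monoˡ-≤    : ∀ z {x y} → x ≤ y → x + z ≤ y + z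
    *-nonNeg     : ∀ {x y} → 0# ≤ x → 0# ≤ y → 0# ≤ x * y

  UpperBound : Pred Carrier 0ℓ → Pred Carrier 0ℓ
  UpperBound P u = ∀ x → P x → x ≤ u

  field
    complete : ∀ (P : Pred Carrier 0ℓ) → ∃ P → ∃ (UpperBound P) →
               ∃ λ s → UpperBound P s × (∀ u → UpperBound P u → s ≤ u)

  open Strict _≈_ _≤_ public using (_<_)
  open SemiringSum semiring public using (sum)

-- |{ x ∈ S ∣ P x }| = k, elements being identified along the equality of S.
HasCardinality : (S : Setoid 0ℓ 0ℓ) → Pred (Setoid.Carrier S) 0ℓ → ℕ → Set
HasCardinality S P k =
  Bijection (setoid (Fin k)) (On.setoid {B = Σ (Setoid.Carrier S) P} S proj₁)

-- A set of subsets of [n], presented by a repetition-free enumeration; the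
-- presentation is forgotten by _≅_ below.
record Collection (n : ℕ) : Set where
  field
    size      : ℕ
    member    : Fin size → Subset n
    injective : Injective _≡_ _≡_ member

open Collection public

infix 4 _∈ᶜ_ _⊆_ _⊂_ _≅_

_∈ᶜ_ : ∀ {n} → Subset n → Collection n → Set
S ∈ᶜ Φ = ∃ λ j → member Φ j ≡ S

_⊆_ _⊂_ _≅_ : ∀ {n} → Rel (Collection n) 0ℓ
Φ ⊆ Ψ = ∀ S → S ∈ᶜ Φ → S ∈ᶜ Ψ
Φ ⊂ Ψ = Φ ⊆ Ψ × ¬ Ψ ⊆ Φ
Φ ≅ Ψ = Φ ⊆ Ψ × Ψ ⊆ Φ

collectionSetoid : ℕ → Setoid 0ℓ 0ℓ
collectionSetoid n = record
  { Carrier       = Collection n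
  ; _≈_           = _≅_
  ; isEquivalence = record
    { refl  = (λ _ p → p) , (λ _ p → p)
    ; sym   = λ (p , q) → q , p
    ; trans = λ (p , q) (p′ , q′) → (λ S → p′ S ∘ p S) , (λ S → q S ∘ q′ S)
    }
  }

-- A simple hypergraph ([n] , E) is determined by its set of edges E ⊆ 2^[n].
Hypergraph : ℕ → Set
Hypergraph = Collection

NonemptyEdges : ∀ {n} → Hypergraph n → Set
NonemptyEdges H = ∀ e → Nonempty (member H e)

module Over (ℝ : RealNumbers) where
  open RealNumbers ℝ

  pointSetoid : ℕ → Setoid 0ℓ 0ℓ
  pointSetoid = VecEq.≋-setoid ℝ-setoid

  open VecEq ℝ-setoid public using (_≋_)

  𝟙 : ∀ {n} → Subset n → Vector Carrier n
  𝟙 S i = if does (i ∈? S) then 1# else 0#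

  incidence : ∀ {n} (H : Hypergraph n) → Fin n → Fin (size H) → Carrier
  incidence H i e = 𝟙 (member H e) i

  infixr 7 _·_
  _·_ : ∀ {n m} → (Fin n → Fin m → Carrier) → Vector Carrier m → Vector Carrier n
  (A · x) i = sum λ e → A i e * x e

  Pfpm : ∀ {n} (H : Hypergraph n) → Pred (Vector Carrier (size H)) 0ℓ
  Pfpm H x = (∀ e → 0# ≤ x e) × incidence H · x ≋ (λ _ → 1#)

  vert : ∀ {m} → Pred (Vector Carrier m) 0ℓ → Pred (Vector Carrier m) 0ℓ
  vert P x = P x × (∀ y z t → P y → P z → 0# < t → t < 1# →
                    x ≋ (λ e → t * y e + (1# - t) * z e) → y ≋ x × z ≋ x)

  Balanced : ∀ {n} → Pred (Collection n) 0ℓ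
  Balanced Φ = ∃ λ (w : Fin (size Φ) → Carrier) →
    (∀ j → 0# < w j) ×
    (λ i → sum λ j → w j * 𝟙 (member Φ j) i) ≋ (λ _ → 1#)

  MinimalBalanced : ∀ {n} → Pred (Collection n) 0ℓ
  MinimalBalanced Φ = Balanced Φ × (∀ Ψ → Ψ ⊂ Φ → ¬ Balanced Ψ)

  ∣vertPfpm_∣≡_ : ∀ {n} → Hypergraph n → ℕ → Set
  ∣vertPfpm H ∣≡ v = HasCardinality (pointSetoid (size H)) (vert (Pfpm H)) v

  B[_]≡_ : ℕ → ℕ → Set
  B[ n ]≡ b = HasCardinality (collectionSetoid n) MinimalBalanced b

infixl 7 _/_!
_/_! : ℕ → ℕ → ℚ.ℚ
a / n ! = (+ a ℚ./ (n !)) {{n !≢0}}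

{-# OPTIONS --safe #-}

-- No nonzero kernel vector d of the incidence matrix is supported in the support of a
-- vertex x, since otherwise x would be the midpoint of the feasible points x ± ε d.
-- Hence the support determines the vertex, is a minimal balanced collection, and has at
-- most n edges.
--
-- The gain of 2^n over the count of n-element sets of edges comes from complements.
-- Modulo 𝟏 the vectors 𝟏_S and 𝟏_(∁ S) are opposite, so a support (unless it is itself
-- of the form {S , ∁ S}) becomes a system of at most n pairs {S , ∁ S} with a linear
-- relation between their classes.  That relation is unique up to a scalar, so the pairs
-- determine the support up to replacing all of its members by their complements, and a
-- single bit settles this.  There are 2^(n-1) pairs, which leaves at most
-- 2 · Σ_{k ≤ n} C(2^(n-1) , k) ≤ 4 · 2^(n² - n) / n! vertices for n ≥ 4.
module Submission where

open import Defs
import Algebra.Properties.Ring as RingProperties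
import Algebra.Properties.Semiring.Sum as SemiringSum
import Algebra.Solver.Ring.NaturalCoefficients.Default as SemiringSolver
open import Axiom.ExcludedMiddle using (ExcludedMiddle)
open import Data.Bool using (Bool; true; false; if_then_else_; not)
open import Data.Bool.Properties using (not-involutive)
open import Data.Fin using (Fin; zero; suc; punchIn; _≟_)
open import Data.Fin.Subset using (Subset; inside; outside; ∁)
open import Data.Fin.Subset.Properties using (_∈?_; x∈p⇒x∉∁p; x∉p⇒x∈∁p)
open import Data.Integer using (+_)
import Data.Integer as ℤ
import Data.Integer.Properties as ℤ
open import Data.List using (List; []; _∷_; [_]; _++_; map; length; filter; lookup; allFin)
open import Data.List.Membership.Propositional using (_∈_)
open import Data.List.Membership.Propositional.Properties
  using (∈-allFin; ∈-map⁺; ∈-map⁻; ∈-++⁺ˡ; ∈-++⁺ʳ; ∈-filter⁺; ∈-filter⁻; ∈-lookup)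
open import Data.List.Properties using (length-map; length-++; length-filter; length-tabulate)
import Data.List.Relation.Unary.AllPairs as AllPairs
open import Data.List.Relation.Unary.All as All using ([])
open import Data.List.Relation.Unary.Any using (here; there)
open import Data.List.Relation.Unary.Unique.Propositional using (Unique)
import Data.List.Relation.Unary.Unique.Propositional.Properties as Unique
import Data.Nat as ℕ
import Data.Nat.Properties as ℕ
open import Data.Nat using (ℕ)
open import Data.Product using (∃; ∃-syntax; Σ-syntax; _×_; _,_; proj₁; proj₂)
open import Data.Rational as ℚ using (ℚ)
import Data.Rational.Properties as ℚ
import Data.Rational.Unnormalised as ℚᵘ
import Data.Rational.Unnormalised.Properties as ℚᵘ
open import Data.Sum using (_⊎_; inj₁; inj₂)
open import Data.Vec using ([]; _∷_; head)
open import Data.Vec.Functional using (Vector; insertAt)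
open import Data.Vec.Functional.Properties using (insertAt-lookup; insertAt-punchIn)
open import Data.Vec.Properties using (∷-injectiveʳ; map-∘; map-cong; map-id)
open import Function using (_∘_)
open import Function.Bundles using (Bijection)
open import Level using (0ℓ)
open import Relation.Binary.Bundles using (Setoid)
open import Relation.Binary.PropositionalEquality as ≡ using (_≡_; setoid)
import Relation.Binary.Reasoning.Setoid as SetoidReasoning
open import Relation.Binary.Structures using (IsTotalOrder)
open import Relation.Nullary using (¬_; yes; no; does; contradiction)
open import Relation.Nullary.Decidable using (dec-true; dec-false; decidable-stable)
open import Relation.Unary using (Pred; Decidable)

∁-involutive : ∀ {n} (S : Subset n) → ∁ (∁ S) ≡ S
∁-involutive S =
  ≡.trans (≡.sym (map-∘ not not S)) (≡.trans (map-cong not-involutive S) (map-id S))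

-- Finite cardinalities from codings

module _ (em : ExcludedMiddle 0ℓ) where

  stable : ∀ {P : Set} → ¬ ¬ P → P
  stable = decidable-stable em

  -- The encoding R is injective up to the equality of S, but it may relate x to several
  -- codes and need not respect that equality.
  enumerate : (S : Setoid 0ℓ 0ℓ) {C : Set} (P : Pred (Setoid.Carrier S) 0ℓ)
              (R : Setoid.Carrier S → C → Set) (cs : List C) →
              (∀ x → P x → ∃ λ c → c ∈ cs × R x c) →
              (∀ x y c → P x → P y → R x c → R y c → Setoid._≈_ S x y) →
              ∃ λ k → HasCardinality S P k × k ℕ.≤ length cs
  enumerate S P R [] total inj = 0 , bijection , ℕ.z≤n
    where
    absurd : ∀ {A : Set} x → P x → A
    absurd x Px with total x Px
    ... | _ , () , _
    bijection : HasCardinality S P 0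
    bijection = record
      { to        = λ ()
      ; cong      = λ { {()} }
      ; bijective = (λ { {()} }) , (λ (x , Px) → absurd x Px)
      }
  enumerate S P R (c ∷ cs) total inj with em {∃ λ a → P a × R a c}
  ... | no ∄a = k , bij , ℕ.m≤n⇒m≤1+n k≤
    where
    total′ : ∀ x → P x → ∃ λ d → d ∈ cs × R x d
    total′ x Px with total x Px
    ... | _ , here ≡.refl , Rxd = contradiction (x , Px , Rxd) ∄a
    ... | d , there d∈cs  , Rxd = d , d∈cs , Rxd
    rest = enumerate S P R cs total′ inj
    k = proj₁ rest
    bij = proj₁ (proj₂ rest)
    k≤ = proj₂ (proj₂ rest)
  ... | yes (a , Pa , Rac) = ℕ.suc k , bij⁺ , ℕ.s≤s k≤
    where
    open Setoid S using (Carrier; _≈_; refl; sym; trans)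
    -- By `inj` every element coded by `c` equals `a`. Removing the whole class of `a` therefore
    -- lets the tail `cs` code what remains, and keeps the new value distinct from all later ones.
    P′ : Pred Carrier 0ℓ
    P′ x = P x × ¬ x ≈ a
    total′ : ∀ x → P′ x → ∃ λ d → d ∈ cs × R x d
    total′ x (Px , x≉a) with total x Px
    ... | _ , here ≡.refl , Rxd = contradiction (inj x a c Px Pa Rxd Rac) x≉a
    ... | d , there d∈cs  , Rxd = d , d∈cs , Rxd
    rest = enumerate S P′ R cs total′ (λ x y d Px Py → inj x y d (proj₁ Px) (proj₁ Py))
    k = proj₁ rest
    k≤ = proj₂ (proj₂ rest)
    open Bijection (proj₁ (proj₂ rest)) using (to; strictlySurjective) renaming (injective to to-injective)
    to⁺ : Fin (ℕ.suc k) → ∃ P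
    to⁺ zero    = a , Pa
    to⁺ (suc i) = proj₁ (to i) , proj₁ (proj₂ (to i))
    injective⁺ : ∀ {i j} → proj₁ (to⁺ i) ≈ proj₁ (to⁺ j) → i ≡ j
    injective⁺ {zero}  {zero}  _  = ≡.refl
    injective⁺ {zero}  {suc j} eq = contradiction (sym eq) (proj₂ (proj₂ (to j)))
    injective⁺ {suc i} {zero}  eq = contradiction eq (proj₂ (proj₂ (to i)))
    injective⁺ {suc i} {suc j} eq = ≡.cong suc (to-injective eq)
    surjective⁺ : ∀ (y : ∃ P) → ∃ λ i → ∀ {j} → j ≡ i → proj₁ (to⁺ j) ≈ proj₁ y
    surjective⁺ (y , Py) with em {y ≈ a}
    ... | yes y≈a = zero , λ { ≡.refl → sym y≈a }
    ... | no  y≉a with strictlySurjective (y , Py , y≉a)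
    ...   | i , eq = suc i , λ { ≡.refl → eq }
    bij⁺ : HasCardinality S P (ℕ.suc k)
    bij⁺ = record
      { to        = to⁺
      ; cong      = λ { ≡.refl → refl }
      ; bijective = injective⁺ , surjective⁺
      }

module FractionalMatchings (em : ExcludedMiddle 0ℓ) (ℝ : RealNumbers) where
  open RealNumbers ℝ hiding (zero)
  open Over ℝ
  open RingProperties ring
    using (-‿distribˡ-*; -‿distribʳ-*; -‿involutive; -0#≈0#; -1*x≈-x; -‿+-comm; +-cancelˡ; +-cancelʳ)
  open SemiringSum semiring
    using (sum-cong-≋; sum-replicate-zero; sum-remove; ∑-comm; ∑-distrib-+; *-distribˡ-sum)
  open SemiringSolver commutativeSemiring using (solve; _:+_; _:*_; _:=_)
  open SetoidReasoning ℝ-setoid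
  private module ≤ = IsTotalOrder isTotalOrder

  -- Ordered field arithmetic

  ≤-resp : ∀ {a b c d} → a ≈ b → c ≈ d → a ≤ c → b ≤ d
  ≤-resp a≈b c≈d a≤c = ≤.trans (≤.reflexive (sym a≈b)) (≤.trans a≤c (≤.reflexive c≈d))

  0≤-resp : ∀ {a b} → a ≈ b → 0# ≤ a → 0# ≤ b
  0≤-resp = ≤-resp refl

  x≤0⇒0≤-x : ∀ {x} → x ≤ 0# → 0# ≤ - x
  x≤0⇒0≤-x {x} x≤0 = ≤-resp (-‿inverseʳ x) (+-identityˡ (- x)) (+-monoˡ-≤ (- x) x≤0)

  0≤x⇒-x≤0 : ∀ {x} → 0# ≤ x → - x ≤ 0#
  0≤x⇒-x≤0 {x} 0≤x = ≤-resp (+-identityˡ (- x)) (-‿inverseʳ x) (+-monoˡ-≤ (- x) 0≤x)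

  x≤y⇒0≤y-x : ∀ {x y} → x ≤ y → 0# ≤ y - x
  x≤y⇒0≤y-x {x} x≤y = ≤-resp (-‿inverseʳ x) refl (+-monoˡ-≤ (- x) x≤y)

  +-nonNeg : ∀ {x y} → 0# ≤ x → 0# ≤ y → 0# ≤ x + y
  +-nonNeg {x} {y} 0≤x 0≤y = ≤.trans 0≤y (≤-resp (+-identityˡ y) refl (+-monoˡ-≤ y 0≤x))

  +-nonPos : ∀ {x y} → x ≤ 0# → y ≤ 0# → x + y ≤ 0#
  +-nonPos {x} {y} x≤0 y≤0 = ≤.trans (+-monoˡ-≤ y x≤0) (≤-resp (sym (+-identityˡ y)) refl y≤0)

  +-nonNeg-≈0 : ∀ {x y} → 0# ≤ x → 0# ≤ y → x + y ≈ 0# → x ≈ 0#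
  +-nonNeg-≈0 {x} {y} 0≤x 0≤y x+y≈0 =
    ≤.antisym (≤-resp (+-identityˡ x) (trans (+-comm y x) x+y≈0) (+-monoˡ-≤ x 0≤y)) 0≤x

  0≤1 : 0# ≤ 1#
  0≤1 with ≤.total 0# 1#
  ... | inj₁ 0≤1 = 0≤1
  ... | inj₂ 1≤0 = 0≤-resp -1*-1≈1 (*-nonNeg (x≤0⇒0≤-x 1≤0) (x≤0⇒0≤-x 1≤0))
    where
    -1*-1≈1 : - 1# * - 1# ≈ 1#
    -1*-1≈1 = trans (-1*x≈-x (- 1#)) (-‿involutive 1#)

  0<1 : 0# < 1#
  0<1 = 0≤1 , 0≉1

  *-≈0⇒≈0 : ∀ {x y} → ¬ x ≈ 0# → x * y ≈ 0# → y ≈ 0#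
  *-≈0⇒≈0 {x} {y} x≉0 xy≈0 with inverse x x≉0
  ... | u , xu≈1 = begin
    y            ≈⟨ *-identityˡ y ⟨
    1# * y       ≈⟨ *-congʳ xu≈1 ⟨
    (x * u) * y  ≈⟨ solve 3 (λ x u y → (x :* u) :* y := u :* (x :* y)) refl x u y ⟩
    u * (x * y)  ≈⟨ *-congˡ xy≈0 ⟩
    u * 0#       ≈⟨ zeroʳ u ⟩
    0#           ∎

  inverse-pos : ∀ {x} → 0# ≤ x → ¬ x ≈ 0# → ∃ λ u → x * u ≈ 1# × 0# ≤ u × ¬ u ≈ 0#
  inverse-pos {x} 0≤x x≉0 with inverse x x≉0
  ... | u , xu≈1 = u , xu≈1 , 0≤u , u≉0
    where
    u≉0 : ¬ u ≈ 0#
    u≉0 u≈0 = 0≉1 (trans (sym (zeroʳ x)) (trans (*-congˡ (sym u≈0)) xu≈1))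
    0≤u : 0# ≤ u
    0≤u with ≤.total 0# u
    ... | inj₁ 0≤u = 0≤u
    -- A nonpositive inverse would make the negative of x * u, which is minus one, nonnegative.
    ... | inj₂ u≤0 = contradiction (≤.antisym 0≤1 1≤0) 0≉1
      where
      1≤0 : 1# ≤ 0#
      1≤0 = ≤-resp (trans (-‿cong (trans (sym (-‿distribʳ-* x u)) (-‿cong xu≈1))) (-‿involutive 1#)) refl
              (0≤x⇒-x≤0 (*-nonNeg 0≤x (x≤0⇒0≤-x u≤0)))

  -- The convex parameter 1/2 against which extremality of a vertex is tested.
  half : ∃ λ h → h + h ≈ 1# × 0# ≤ h
  half with inverse-pos (+-nonNeg 0≤1 0≤1) (λ 1+1≈0 → 0≉1 (sym (+-nonNeg-≈0 0≤1 0≤1 1+1≈0)))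
  ... | h , 2h≈1 , 0≤h , _ = h , h+h≈1 , 0≤h
    where
    h+h≈1 : h + h ≈ 1#
    h+h≈1 = begin
      h + h              ≈⟨ +-cong (*-identityˡ h) (*-identityˡ h) ⟨
      1# * h + 1# * h    ≈⟨ distribʳ h 1# 1# ⟨
      (1# + 1#) * h      ≈⟨ 2h≈1 ⟩
      1#                 ∎

  -- Small moves in the nonnegative orthant

  StaysNonNeg : ∀ {m} → Vector Carrier m → Vector Carrier m → Carrier → Set
  StaysNonNeg x d ε = ∀ δ → 0# ≤ δ → δ ≤ ε → ∀ e → 0# ≤ x e + δ * d e

  perturb₁ : ∀ x d → 0# ≤ x → (x ≈ 0# → d ≈ 0#) →
             ∃ λ ε → 0# < ε × (∀ δ → 0# ≤ δ → δ ≤ ε → 0# ≤ x + δ * d)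
  perturb₁ x d 0≤x x≈0⇒d≈0 with ≤.total 0# d
  ... | inj₁ 0≤d = 1# , 0<1 , λ δ 0≤δ _ → +-nonNeg 0≤x (*-nonNeg 0≤δ 0≤d)
  ... | inj₂ d≤0 with em {d ≈ 0#}
  ...   | yes d≈0 = 1# , 0<1 , λ δ 0≤δ _ →
          0≤-resp (trans (sym (+-identityʳ x)) (+-congˡ (sym (trans (*-congˡ d≈0) (zeroʳ δ))))) 0≤x
  ...   | no  d≉0 with inverse-pos (x≤0⇒0≤-x d≤0)
                         (λ -d≈0 → d≉0 (trans (sym (-‿involutive d)) (trans (-‿cong -d≈0) -0#≈0#)))
  -- The ratio x / (- d) is the step at which the coordinate would reach 0, and x + δ d = (x / (- d)
  -- - δ) (- d). It is nonzero since d ≠ 0 forces x ≠ 0.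
  ...     | u , -du≈1 , 0≤u , u≉0 = x * u , (*-nonNeg 0≤x 0≤u , 0≉xu) , bound
    where
    0≉xu : ¬ 0# ≈ x * u
    0≉xu 0≈xu = u≉0 (*-≈0⇒≈0 (d≉0 ∘ x≈0⇒d≈0) (sym 0≈xu))
    bound : ∀ δ → 0# ≤ δ → δ ≤ x * u → 0# ≤ x + δ * d
    bound δ 0≤δ δ≤xu = 0≤-resp eq (*-nonNeg (x≤y⇒0≤y-x δ≤xu) (x≤0⇒0≤-x d≤0))
      where
      eq : (x * u - δ) * - d ≈ x + δ * d
      eq = begin
        (x * u - δ) * - d              ≈⟨ distribʳ (- d) (x * u) (- δ) ⟩
        x * u * - d + - δ * - d        ≈⟨ +-cong (trans (*-assoc x u (- d)) (*-congˡ (trans (*-comm u (- d)) -du≈1)))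
                                                 (trans (sym (-‿distribʳ-* (- δ) d)) (-‿cong (sym (-‿distribˡ-* δ d)))) ⟩
        x * 1# + - - (δ * d)           ≈⟨ +-cong (*-identityʳ x) (-‿involutive (δ * d)) ⟩
        x + δ * d                      ∎

  min : ∀ {ε₁ ε₂} → 0# < ε₁ → 0# < ε₂ → ∃ λ ε → 0# < ε × ε ≤ ε₁ × ε ≤ ε₂
  min {ε₁} {ε₂} p₁ p₂ with ≤.total ε₁ ε₂
  ... | inj₁ le = ε₁ , p₁ , ≤.refl , le
  ... | inj₂ le = ε₂ , p₂ , le , ≤.refl

  -- Each coordinate admits all steps up to its own bound, so the minimum of the bounds serves every
  -- coordinate. Asking for all smaller steps, and not just for ε, is what makes this work.
  perturb : ∀ {m} (x d : Vector Carrier m) → (∀ e → 0# ≤ x e) → (∀ e → x e ≈ 0# → d e ≈ 0#) →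
            ∃ λ ε → 0# < ε × StaysNonNeg x d ε
  perturb {ℕ.zero}  x d _   _    = 1# , 0<1 , λ _ _ _ ()
  perturb {ℕ.suc m} x d 0≤x supp
    with perturb₁ (x zero) (d zero) (0≤x zero) (supp zero)
       | perturb (x ∘ suc) (d ∘ suc) (0≤x ∘ suc) (supp ∘ suc)
  ... | ε₁ , 0<ε₁ , h₁ | ε₂ , 0<ε₂ , h₂ with min 0<ε₁ 0<ε₂
  ...   | ε , 0<ε , ε≤ε₁ , ε≤ε₂ = ε , 0<ε , λ
          { δ 0≤δ δ≤ε zero    → h₁ δ 0≤δ (≤.trans δ≤ε ε≤ε₁)
          ; δ 0≤δ δ≤ε (suc e) → h₂ δ 0≤δ (≤.trans δ≤ε ε≤ε₂) e
          }

  -- Finite sums and pushforwards of weights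

  sum-zero : ∀ {m} (f : Vector Carrier m) → (∀ e → f e ≈ 0#) → sum f ≈ 0#
  sum-zero {m} f f≈0 = trans (sum-cong-≋ f≈0) (sum-replicate-zero m)

  sum-nonNeg : ∀ {m} (f : Vector Carrier m) → (∀ e → 0# ≤ f e) → 0# ≤ sum f
  sum-nonNeg {ℕ.zero}  f _   = ≤.refl
  sum-nonNeg {ℕ.suc m} f 0≤f = +-nonNeg (0≤f zero) (sum-nonNeg (f ∘ suc) (0≤f ∘ suc))

  sum-nonPos : ∀ {m} (f : Vector Carrier m) → (∀ e → f e ≤ 0#) → sum f ≤ 0#
  sum-nonPos {ℕ.zero}  f _   = ≤.refl
  sum-nonPos {ℕ.suc m} f f≤0 = +-nonPos (f≤0 zero) (sum-nonPos (f ∘ suc) (f≤0 ∘ suc))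

  sum-nonNeg-≈0 : ∀ {m} (f : Vector Carrier m) → (∀ e → 0# ≤ f e) → sum f ≈ 0# → ∀ e → f e ≈ 0#
  sum-nonNeg-≈0 f 0≤f ∑≈0 zero    = +-nonNeg-≈0 (0≤f zero) (sum-nonNeg (f ∘ suc) (0≤f ∘ suc)) ∑≈0
  sum-nonNeg-≈0 f 0≤f ∑≈0 (suc e) = sum-nonNeg-≈0 (f ∘ suc) (0≤f ∘ suc)
    (+-nonNeg-≈0 (sum-nonNeg (f ∘ suc) (0≤f ∘ suc)) (0≤f zero) (trans (+-comm _ _) ∑≈0)) e

  sum-single : ∀ {m} (f : Vector Carrier m) p → (∀ e → ¬ p ≡ e → f e ≈ 0#) → sum f ≈ f p
  sum-single f zero    f≈0 = trans (+-congˡ (sum-zero (f ∘ suc) (λ e → f≈0 (suc e) λ ()))) (+-identityʳ _)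
  sum-single f (suc p) f≈0 = trans (+-cong (f≈0 zero λ ()) (sum-single (f ∘ suc) p (λ e p≢e → f≈0 (suc e) λ { ≡.refl → p≢e ≡.refl })))
                                   (+-identityˡ _)

  point : ∀ {m} → Fin m → Carrier → Vector Carrier m
  point p c e = if does (p ≟ e) then c else 0#

  point-elim : ∀ {m} (Q : Pred Carrier 0ℓ) (p : Fin m) c e → (p ≡ e → Q c) → Q 0# → Q (point p c e)
  point-elim Q p c e Qc Q0 with p ≟ e
  ... | yes p≡e = Qc p≡e
  ... | no  _   = Q0

  point-≡ : ∀ {m} (p : Fin m) c → point p c p ≡ c
  point-≡ p c rewrite dec-true (p ≟ p) ≡.refl = ≡.refl

  point-≢ : ∀ {m} (p : Fin m) c e → ¬ p ≡ e → point p c e ≡ 0#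
  point-≢ p c e p≢e rewrite dec-false (p ≟ e) p≢e = ≡.refl

  sum-point : ∀ {m} (a : Vector Carrier m) p c → sum (λ e → a e * point p c e) ≈ a p * c
  sum-point a p c =
    trans (sum-single _ p (λ e p≢e → trans (*-congˡ (reflexive (point-≢ p c e p≢e))) (zeroʳ (a e))))
          (*-congˡ (reflexive (point-≡ p c)))

  -- The pushforward of a weight along `g`. It turns weights on a list of edges into a vector
  -- indexed by all edges, adding them up where `g` repeats a value.
  push : ∀ {k m} → (Fin k → Fin m) → Vector Carrier k → Vector Carrier m
  push g w e = sum λ j → point (g j) (w j) e

  push-≈0 : ∀ {k m} (g : Fin k → Fin m) w e → (∀ j → g j ≡ e → w j ≈ 0#) → push g w e ≈ 0#
  push-≈0 g w e w≈0 = sum-zero _ λ j → point-elim (_≈ 0#) (g j) (w j) e (w≈0 j) refl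

  push-nonNeg : ∀ {k m} (g : Fin k → Fin m) w e → (∀ j → g j ≡ e → 0# ≤ w j) → 0# ≤ push g w e
  push-nonNeg g w e 0≤w = sum-nonNeg _ λ j → point-elim (0# ≤_) (g j) (w j) e (0≤w j) ≤.refl

  push-nonPos : ∀ {k m} (g : Fin k → Fin m) w e → (∀ j → g j ≡ e → w j ≤ 0#) → push g w e ≤ 0#
  push-nonPos g w e w≤0 = sum-nonPos _ λ j → point-elim (_≤ 0#) (g j) (w j) e (w≤0 j) ≤.refl

  push-nonNeg-≈0 : ∀ {k m} (g : Fin k → Fin m) w e → (∀ j → g j ≡ e → 0# ≤ w j) →
                   push g w e ≈ 0# → ∀ j → g j ≡ e → w j ≈ 0#
  push-nonNeg-≈0 g w e 0≤w ≈0 j ≡.refl =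
    trans (reflexive (≡.sym (point-≡ (g j) (w j))))
          (sum-nonNeg-≈0 _ (λ l → point-elim (0# ≤_) (g l) (w l) e (0≤w l) ≤.refl) ≈0 j)

  push-injective : ∀ {k m} (g : Fin k → Fin m) w → (∀ {j l} → g j ≡ g l → j ≡ l) →
                   ∀ j → push g w (g j) ≈ w j
  push-injective g w inj j =
    trans (sum-single _ j (λ l j≢l → reflexive (point-≢ (g l) (w l) (g j) (λ eq → j≢l (inj (≡.sym eq))))))
          (reflexive (point-≡ (g j) (w j)))

  -- Change of variables: once the sums are exchanged, each j contributes a single point mass at
  -- `g j`.
  sum-push : ∀ {k m} (a : Vector Carrier m) (g : Fin k → Fin m) w →
             sum (λ e → a e * push g w e) ≈ sum (λ j → a (g j) * w j)
  sum-push {k} {m} a g w = begin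
    sum (λ e → a e * push g w e)
      ≈⟨ sum-cong-≋ (λ e → *-distribˡ-sum (a e) (λ j → point (g j) (w j) e)) ⟩
    sum (λ e → sum (λ j → a e * point (g j) (w j) e))
      ≈⟨ ∑-comm (λ e j → a e * point (g j) (w j) e) ⟩
    sum (λ j → sum (λ e → a e * point (g j) (w j) e))
      ≈⟨ sum-cong-≋ (λ j → sum-point a (g j) (w j)) ⟩
    sum (λ j → a (g j) * w j) ∎

  -- Linear dependence of more vectors than dimensions

  dependent : ∀ {n k} → n ℕ.< k → (M : Fin k → Vector Carrier n) →
              ∃ λ (c : Vector Carrier k) → (∃ λ j → ¬ c j ≈ 0#) × (∀ i → sum (λ j → M j i * c j) ≈ 0#)
  dependent {ℕ.zero}  {ℕ.suc k} _ M = (λ _ → 1#) , (zero , 0≉1 ∘ sym) , λ ()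
  dependent {ℕ.suc n} {ℕ.suc k} (ℕ.s≤s n<k) M with em {∃ λ p → ¬ M p zero ≈ 0#}
  ... | no ∄p with dependent (ℕ.m≤n⇒m≤1+n n<k) (λ j i → M j (suc i))
  ...   | c , c≉0 , rel = c , c≉0 , λ
          { zero    → sum-zero _ λ j → trans (*-congʳ (stable em λ M≉0 → ∄p (j , M≉0))) (zeroˡ (c j))
          ; (suc i) → rel i
          }
  -- Gaussian elimination: vector p, with nonzero coordinate 0, clears that coordinate in the other
  -- k vectors, and induction applies to these in dimension n.
  dependent {ℕ.suc n} {ℕ.suc k} (ℕ.s≤s n<k) M | yes (p , a≉0) =
    c , (punchIn p j₀ , λ c≈0 → c′≉0 (trans (reflexive (≡.sym (insertAt-punchIn c′ p (v * r) j₀))) c≈0)) , rel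
    where
    a = M p zero
    u = proj₁ (inverse a a≉0)
    v = - u
    av≈-1 : a * v ≈ - 1#
    av≈-1 = trans (sym (-‿distribʳ-* a u)) (-‿cong (proj₂ (inverse a a≉0)))
    N : Fin k → Vector Carrier (ℕ.suc n)
    N l = M (punchIn p l)
    eliminated = dependent n<k (λ l i → N l (suc i) + M p (suc i) * (v * N l zero))
    c′ = proj₁ eliminated
    j₀ = proj₁ (proj₁ (proj₂ eliminated))
    c′≉0 = proj₂ (proj₁ (proj₂ eliminated))
    r = sum λ l → N l zero * c′ l
    -- The pivot gets the coefficient that cancels coordinate 0: a * v is minus one, and r is what
    -- the other vectors contribute there.
    c = insertAt c′ p (v * r)
    split : ∀ i → sum (λ j → M j i * c j) ≈ M p i * (v * r) + sum (λ l → N l i * c′ l)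
    split i = trans (sum-remove {i = p} (λ j → M j i * c j))
      (+-cong (*-congˡ (reflexive (insertAt-lookup c′ p (v * r))))
              (sum-cong-≋ λ l → *-congˡ {N l i} (reflexive (insertAt-punchIn c′ p (v * r) l))))
    rel : ∀ i → sum (λ j → M j i * c j) ≈ 0#
    rel zero = begin
      sum (λ j → M j zero * c j)  ≈⟨ split zero ⟩
      a * (v * r) + r             ≈⟨ +-congʳ (*-assoc a v r) ⟨
      a * v * r + r               ≈⟨ +-congʳ (trans (*-congʳ av≈-1) (-1*x≈-x r)) ⟩
      - r + r                     ≈⟨ -‿inverseˡ r ⟩
      0#                          ∎
    rel (suc i) = begin
      sum (λ j → M j (suc i) * c j)
        ≈⟨ split (suc i) ⟩
      q * (v * r) + sum (λ l → N l (suc i) * c′ l)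
        ≈⟨ +-comm _ _ ⟩
      sum (λ l → N l (suc i) * c′ l) + q * (v * r)
        ≈⟨ +-congˡ (trans (sym (*-assoc q v r)) (*-distribˡ-sum (q * v) (λ l → N l zero * c′ l))) ⟩
      sum (λ l → N l (suc i) * c′ l) + sum (λ l → q * v * (N l zero * c′ l))
        ≈⟨ ∑-distrib-+ (λ l → N l (suc i) * c′ l) (λ l → q * v * (N l zero * c′ l)) ⟨
      sum (λ l → N l (suc i) * c′ l + q * v * (N l zero * c′ l))
        ≈⟨ sum-cong-≋ (λ l → solve 5 (λ b q v m c → (b :+ q :* (v :* m)) :* c := b :* c :+ q :* v :* (m :* c))
                                     refl (N l (suc i)) q v (N l zero) (c′ l)) ⟨
      sum (λ l → (N l (suc i) + q * (v * N l zero)) * c′ l)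
        ≈⟨ proj₂ (proj₂ eliminated) i ⟩
      0# ∎
      where q = M p (suc i)

  halfway : ∀ h x ε d → h + h ≈ 1# → x ≈ h * (x + ε * d) + (1# - h) * (x + - ε * d)
  halfway h x ε d h+h≈1 = sym (begin
    h * (x + ε * d) + (1# - h) * (x + - ε * d)  ≈⟨ +-congˡ (*-congʳ 1-h≈h) ⟩
    h * (x + ε * d) + h * (x + - ε * d)         ≈⟨ solve 5 (λ h x ε ε′ d → h :* (x :+ ε :* d) :+ h :* (x :+ ε′ :* d) := (h :+ h) :* x :+ h :* ((ε :+ ε′) :* d))
                                                            refl h x ε (- ε) d ⟩
    (h + h) * x + h * ((ε - ε) * d)             ≈⟨ +-cong (*-congʳ h+h≈1) (*-congˡ (trans (*-congʳ (-‿inverseʳ ε)) (zeroˡ d))) ⟩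
    1# * x + h * 0#                             ≈⟨ +-cong (*-identityˡ x) (zeroʳ h) ⟩
    x + 0#                                      ≈⟨ +-identityʳ x ⟩
    x                                           ∎)
    where
    1-h≈h : 1# - h ≈ h
    1-h≈h = begin
      1# - h       ≈⟨ +-congʳ h+h≈1 ⟨
      h + h - h    ≈⟨ +-assoc h h (- h) ⟩
      h + (h - h)  ≈⟨ +-congˡ (-‿inverseʳ h) ⟩
      h + 0#       ≈⟨ +-identityʳ h ⟩
      h            ∎

  ·-linear : ∀ {n m} (A : Fin n → Fin m → Carrier) x c d i →
             (A · λ e → x e + c * d e) i ≈ (A · x) i + c * (A · d) i
  ·-linear A x c d i = begin
    sum (λ e → A i e * (x e + c * d e))
      ≈⟨ sum-cong-≋ (λ e → solve 4 (λ a x c d → a :* (x :+ c :* d) := a :* x :+ c :* (a :* d)) refl (A i e) (x e) c (d e)) ⟩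
    sum (λ e → A i e * x e + c * (A i e * d e))
      ≈⟨ ∑-distrib-+ (λ e → A i e * x e) (λ e → c * (A i e * d e)) ⟩
    (A · x) i + sum (λ e → c * (A i e * d e))
      ≈⟨ +-congˡ (*-distribˡ-sum c (λ e → A i e * d e)) ⟨
    (A · x) i + c * (A · d) i ∎

  infix 4 _⊆ₛ_
  -- Inclusion of supports, stated contrapositively through zero entries.
  _⊆ₛ_ : ∀ {m} → Vector Carrier m → Vector Carrier m → Set
  d ⊆ₛ x = ∀ e → x e ≈ 0# → d e ≈ 0#

  𝟙-∁ : ∀ {n} (S : Subset n) i → 𝟙 (∁ S) i + 𝟙 S i ≈ 1#
  𝟙-∁ S i with i ∈? S
  ... | yes i∈S rewrite dec-false (i ∈? ∁ S) (x∈p⇒x∉∁p i∈S) = +-identityˡ 1#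
  ... | no  i∉S rewrite dec-true (i ∈? ∁ S) (x∉p⇒x∈∁p i∉S) = +-identityʳ 1#

  -- Vertices and their supports

  module _ {n} (H : Hypergraph n) where

    private
      A = incidence H
      m = size H

    vertex-kernel : ∀ {x} d → vert (Pfpm H) x → (∀ i → (A · d) i ≈ 0#) → d ⊆ₛ x → ∀ e → d e ≈ 0#
    vertex-kernel {x} d ((0≤x , Ax≈1) , extreme) Ad≈0 d⊆x e
      with half
         | perturb x d 0≤x d⊆x
         | perturb x (λ e → - d e) 0≤x (λ e x≈0 → trans (-‿cong (d⊆x e x≈0)) -0#≈0#)
    ... | h , h+h≈1 , 0≤h | ε₁ , 0<ε₁ , stays₁ | ε₂ , 0<ε₂ , stays₂ with min 0<ε₁ 0<ε₂
    ...   | ε , (0≤ε , 0≉ε) , ε≤ε₁ , ε≤ε₂ =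
      -- Extremality gives x + ε d = x; cancelling x and then ε leaves d = 0.
      *-≈0⇒≈0 (0≉ε ∘ sym) (+-cancelˡ (x e) _ _ (trans (y≋x e) (sym (+-identityʳ (x e)))))
      where
      moved : Carrier → Vector Carrier m
      moved c e = x e + c * d e
      A·moved : ∀ c i → (A · moved c) i ≈ 1#
      A·moved c i = begin
        (A · moved c) i            ≈⟨ ·-linear A x c d i ⟩
        (A · x) i + c * (A · d) i  ≈⟨ +-cong (Ax≈1 i) (trans (*-congˡ (Ad≈0 i)) (zeroʳ c)) ⟩
        1# + 0#                    ≈⟨ +-identityʳ 1# ⟩
        1#                         ∎
      -εd : ∀ e → x e + ε * - d e ≈ moved (- ε) e
      -εd e = +-congˡ (trans (sym (-‿distribʳ-* ε (d e))) (-‿distribˡ-* ε (d e)))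
      h≉0 : ¬ 0# ≈ h
      h≉0 0≈h = 0≉1 (trans (sym (+-identityʳ 0#)) (trans (+-cong 0≈h 0≈h) h+h≈1))
      h≤1 : h ≤ 1#
      h≤1 = ≤-resp (+-identityˡ h) h+h≈1 (+-monoˡ-≤ h 0≤h)
      h≉1 : ¬ h ≈ 1#
      h≉1 h≈1 = h≉0 (sym (+-cancelˡ h h 0# (trans h+h≈1 (trans (sym h≈1) (sym (+-identityʳ h))))))
      y≋x : moved ε ≋ x
      y≋x = proj₁ (extreme (moved ε) (moved (- ε)) h
        (stays₁ ε 0≤ε ε≤ε₁ , A·moved ε)
        ((λ e → 0≤-resp (-εd e) (stays₂ ε 0≤ε ε≤ε₂ e)) , A·moved (- ε))
        (0≤h , h≉0) (h≤1 , h≉1) (λ e → halfway h (x e) ε (d e) h+h≈1))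

    -- The difference x - y is a kernel vector supported in the support of x. The point y is only
    -- asked to be feasible, so that candidates built by `push` qualify.
    vertex-unique : ∀ {x y} → vert (Pfpm H) x → Pfpm H y → y ⊆ₛ x → x ≋ y
    vertex-unique {x} {y} vx@((_ , Ax≈1) , _) (_ , Ay≈1) y⊆x e =
      +-cancelʳ (- 1# * y e) (x e) (y e) (trans (d≈0 e) (sym y-y≈0))
      where
      y-y≈0 : y e + - 1# * y e ≈ 0#
      y-y≈0 = trans (+-congˡ (-1*x≈-x (y e))) (-‿inverseʳ (y e))
      d≈0 : ∀ e → x e + - 1# * y e ≈ 0#
      d≈0 = vertex-kernel _ vx
        (λ i → trans (·-linear A x (- 1#) y i)
               (trans (+-cong (Ax≈1 i) (trans (*-congˡ (Ay≈1 i)) (*-identityʳ (- 1#)))) (-‿inverseʳ 1#)))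
        (λ e x≈0 → trans (+-cong x≈0 (trans (*-congˡ (y⊆x e x≈0)) (zeroʳ (- 1#)))) (+-identityʳ 0#))

    push-Pfpm : ∀ {k} (g : Fin k → Fin m) w → (∀ j → 0# ≤ w j) →
                (∀ i → sum (λ j → A i (g j) * w j) ≈ 1#) → Pfpm H (push g w)
    push-Pfpm g w 0≤w Aw≈1 =
      (λ e → push-nonNeg g w e (λ j _ → 0≤w j)) ,
      (λ i → trans (sum-push (A i) g w) (Aw≈1 i))

    nonempty-support : ∀ {x} → Fin n → Pfpm H x → ∃ λ e → ¬ x e ≈ 0#
    nonempty-support {x} i (_ , Ax≈1) = stable em λ ∄e →
      0≉1 (trans (sym (sum-zero _ λ e → trans (*-congˡ (stable em λ x≉0 → ∄e (e , x≉0))) (zeroʳ (A i e)))) (Ax≈1 i))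

    -- More than n columns of A are dependent. Pushed along `g`, a dependence becomes a kernel
    -- vector supported in the support of x, and injectivity of `g` keeps it nonzero.
    supported-injective⇒≤ : ∀ {x k} → vert (Pfpm H) x → (g : Fin k → Fin m) →
                            (∀ {j l} → g j ≡ g l → j ≡ l) → (∀ j → ¬ x (g j) ≈ 0#) → k ℕ.≤ n
    supported-injective⇒≤ {x} vx g inj x≉0 = ℕ.≮⇒≥ λ n<k →
      let c , (j , c≉0) , rel = dependent n<k (λ j i → A i (g j))
          d≈0 = vertex-kernel (push g c) vx
                  (λ i → trans (sum-push (A i) g c) (rel i))
                  (λ { e x≈0 → push-≈0 g c e λ { j ≡.refl → contradiction x≈0 (x≉0 j) } })
      in c≉0 (trans (sym (push-injective g c inj j)) (d≈0 (g j)))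

    -- Vertices whose supports meet the same complement pairs

    Covered : Vector Carrier m → Vector Carrier m → Set
    Covered x y = ∀ e → ¬ x e ≈ 0# →
      ∃ λ f → ¬ y f ≈ 0# × (e ≡ f ⊎ member H f ≡ ∁ (member H e))

    -- Singles out the supports in which two edges fall into one pair.
    HasComplements : Vector Carrier m → Set
    HasComplements x = ∃ λ p → ∃ λ q → ¬ x p ≈ 0# × ¬ x q ≈ 0# × member H p ≡ ∁ (member H q)

    -- The two complementary edges with weight 1 form a feasible point, hence are the whole vertex
    -- x. Each edge of y is one of them or the complement of one, so again one of them, and the
    -- support of y lies in that of x.
    complements-unique : ∀ {x y} → vert (Pfpm H) x → Pfpm H y → HasComplements x → Covered y x → x ≋ y
    complements-unique {x} {y} vx Py (p , q , xp≉0 , xq≉0 , p≡∁q) cov = vertex-unique vx Py y⊆x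
      where
      ends : Fin 2 → Fin m
      ends zero    = p
      ends (suc _) = q
      x≋pq : x ≋ push ends (λ _ → 1#)
      x≋pq = vertex-unique vx
        (push-Pfpm ends (λ _ → 1#) (λ _ → 0≤1) λ i → begin
          A i p * 1# + (A i q * 1# + 0#)  ≈⟨ +-cong (*-identityʳ _) (trans (+-identityʳ _) (*-identityʳ _)) ⟩
          A i p + A i q                   ≈⟨ +-congʳ (reflexive (≡.cong (λ S → 𝟙 S i) p≡∁q)) ⟩
          𝟙 (∁ (member H q)) i + A i q    ≈⟨ 𝟙-∁ (member H q) i ⟩
          1#                              ∎)
        (λ e x≈0 → push-≈0 ends (λ _ → 1#) e λ
          { zero       ≡.refl → contradiction x≈0 xp≉0
          ; (suc zero) ≡.refl → contradiction x≈0 xq≉0 })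
      support : ∀ f → ¬ x f ≈ 0# → f ≡ p ⊎ f ≡ q
      support f x≉0 with f ≟ p | f ≟ q
      ... | yes f≡p | _       = inj₁ f≡p
      ... | no  _   | yes f≡q = inj₂ f≡q
      ... | no  f≢p | no  f≢q = contradiction
        (trans (x≋pq f) (push-≈0 ends (λ _ → 1#) f λ
          { zero       p≡f → contradiction (≡.sym p≡f) f≢p
          ; (suc zero) q≡f → contradiction (≡.sym q≡f) f≢q })) x≉0
      q≡∁p : member H q ≡ ∁ (member H p)
      q≡∁p = ≡.trans (≡.sym (∁-involutive (member H q))) (≡.cong ∁ (≡.sym p≡∁q))
      y⊆x : y ⊆ₛ x
      y⊆x e x≈0 = stable em λ y≉0 → absurd (cov e y≉0)
        where
        absurd : ¬ (∃ λ f → ¬ x f ≈ 0# × (e ≡ f ⊎ member H f ≡ ∁ (member H e)))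
        absurd (f , xf≉0 , inj₁ ≡.refl) = xf≉0 x≈0
        absurd (f , xf≉0 , inj₂ f≡∁e) with support f xf≉0
        ... | inj₁ ≡.refl = xq≉0 (trans (reflexive (≡.cong x (injective H
                (≡.trans q≡∁p (≡.trans (≡.cong ∁ f≡∁e) (∁-involutive (member H e))))))) x≈0)
        ... | inj₂ ≡.refl = xp≉0 (trans (reflexive (≡.cong x (injective H
                (≡.trans p≡∁q (≡.trans (≡.cong ∁ f≡∁e) (∁-involutive (member H e))))))) x≈0)

    -- Replacing each edge f of y outside supp x by its complement, with weight - y f, gives
    -- y′ supported in supp x with A y′ = s 𝟏, so y′ = s x.  A common edge forces s > 0, and
    -- then no edge of x can be the complement of an edge of y.
    covered-unique : ∀ {x y} → vert (Pfpm H) x → vert (Pfpm H) y →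
                     ¬ HasComplements x → ¬ HasComplements y → Covered y x →
                     (∃ λ e → ¬ x e ≈ 0# × ¬ y e ≈ 0#) → x ≋ y
    covered-unique {x} {y} vx@(Px@(0≤x , Ax≈1) , _) vy@((0≤y , Ay≈1) , _) ¬cx ¬cy cov (e₀ , x₀≉0 , y₀≉0) =
      λ e → sym (vertex-unique vy Px x⊆y e)
      where
      Partner : Fin m → Set
      Partner f = ∃ λ g → (¬ y f ≈ 0# → ¬ x g ≈ 0#) × (f ≡ g ⊎ member H g ≡ ∁ (member H f))
      partner : ∀ f → Partner f
      partner f with em {y f ≈ 0#}
      -- Off the support of y the default partner is f itself, which carries weight 0.
      ... | yes y≈0 = f , (λ y≉0 → contradiction y≈0 y≉0) , inj₁ ≡.refl
      ... | no  y≉0 with cov f y≉0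
      ...   | g , x≉0 , f~g = g , (λ _ → x≉0) , f~g
      φ : Fin m → Fin m
      φ f = proj₁ (partner f)
      -- Complementing negates the class of an edge modulo 𝟏: `sign` is this factor, and `shift` is
      -- the multiple of 𝟏 left over, as `A-sign` records.
      sign shift : ∀ {f g} → f ≡ g ⊎ member H g ≡ ∁ (member H f) → Carrier
      sign  (inj₁ _) = 1#
      sign  (inj₂ _) = - 1#
      shift (inj₁ _) = 0#
      shift (inj₂ _) = - 1#
      τ γ w : Vector Carrier m
      τ f = sign (proj₂ (proj₂ (partner f)))
      γ f = shift (proj₂ (proj₂ (partner f)))
      w f = τ f * y f
      A-sign : ∀ {f g} (r : f ≡ g ⊎ member H g ≡ ∁ (member H f)) i → A i g * sign r ≈ A i f + shift r
      A-sign (inj₁ ≡.refl) i = trans (*-identityʳ _) (sym (+-identityʳ _))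
      A-sign {f} {g} (inj₂ g≡∁f) i = begin
        A i g * - 1#                                 ≈⟨ trans (*-comm _ _) (-1*x≈-x _) ⟩
        - A i g                                      ≈⟨ +-identityˡ _ ⟨
        0# - A i g                                   ≈⟨ +-congʳ (-‿inverseʳ (A i f)) ⟨
        A i f - A i f - A i g                        ≈⟨ +-assoc _ _ _ ⟩
        A i f + (- A i f - A i g)                    ≈⟨ +-congˡ (trans (+-comm _ _) (-‿+-comm _ _)) ⟩
        A i f - (A i g + A i f)                      ≈⟨ +-congˡ (-‿cong (+-congʳ (reflexive (≡.cong (λ S → 𝟙 S i) g≡∁f)))) ⟩
        A i f - (𝟙 (∁ (member H f)) i + A i f)       ≈⟨ +-congˡ (-‿cong (𝟙-∁ (member H f) i)) ⟩
        A i f - 1#                                   ∎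
      y′ : Vector Carrier m
      y′ = push φ w
      -- The summand 1 comes from A y = 𝟏, and each complemented edge subtracts its weight.
      s = 1# + sum (λ f → γ f * y f)
      Ay′≈s : ∀ i → (A · y′) i ≈ s
      Ay′≈s i = begin
        (A · y′) i                                     ≈⟨ sum-push (A i) φ w ⟩
        sum (λ f → A i (φ f) * (τ f * y f))            ≈⟨ sum-cong-≋ (λ f → trans (sym (*-assoc _ _ _))
                                                            (trans (*-congʳ (A-sign (proj₂ (proj₂ (partner f))) i)) (distribʳ _ _ _))) ⟩
        sum (λ f → A i f * y f + γ f * y f)            ≈⟨ ∑-distrib-+ (λ f → A i f * y f) (λ f → γ f * y f) ⟩
        (A · y) i + sum (λ f → γ f * y f)              ≈⟨ +-congʳ (Ay≈1 i) ⟩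
        s                                              ∎
      w≈0 : ∀ {f} → y f ≈ 0# → w f ≈ 0#
      w≈0 y≈0 = trans (*-congˡ y≈0) (zeroʳ _)
      y′⊆x : y′ ⊆ₛ x
      y′⊆x e x≈0 = push-≈0 φ w e λ { f ≡.refl → w≈0 (stable em λ y≉0 → proj₁ (proj₂ (partner f)) y≉0 x≈0) }
      -- The vector y′ - s x lies in the kernel and is supported in the support of x.
      y′≈sx : ∀ e → y′ e ≈ s * x e
      y′≈sx e = +-cancelʳ (- s * x e) _ _ (trans (d≈0 e) (sym (trans (sym (distribʳ (x e) s (- s))) (trans (*-congʳ (-‿inverseʳ s)) (zeroˡ (x e))))))
        where
        d≈0 : ∀ e → y′ e + - s * x e ≈ 0#
        d≈0 = vertex-kernel _ vx
          (λ i → trans (·-linear A y′ (- s) x i)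
                 (trans (+-cong (Ay′≈s i) (trans (*-congˡ (Ax≈1 i)) (*-identityʳ (- s)))) (-‿inverseʳ s)))
          (λ e x≈0 → trans (+-cong (y′⊆x e x≈0) (trans (*-congˡ x≈0) (zeroʳ (- s)))) (+-identityʳ 0#))

      -- A negative contribution at e₀ could come only from an edge of y complementary to e₀, but e₀
      -- is itself an edge of y.
      w-nonNeg₀ : ∀ f → φ f ≡ e₀ → 0# ≤ w f
      w-nonNeg₀ f eq with partner f
      ... | g , _ , inj₁ _ = 0≤-resp (sym (*-identityˡ (y f))) (0≤y f)
      w-nonNeg₀ f ≡.refl | g , _ , inj₂ g≡∁f = ≤.reflexive (sym (trans (*-congˡ yf≈0) (zeroʳ _)))
        where
        yf≈0 : y f ≈ 0#
        yf≈0 = stable em λ yf≉0 → ¬cy (g , f , y₀≉0 , yf≉0 , g≡∁f)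
      -- The edge e₀ is its own partner, since its complement cannot also be an edge of x. Hence y′
      -- is positive at e₀.
      w₀≉0 : ∃ λ f → φ f ≡ e₀ × ¬ w f ≈ 0#
      w₀≉0 = e₀ , go
        where
        go : φ e₀ ≡ e₀ × ¬ w e₀ ≈ 0#
        go with partner e₀
        ... | g , _ , inj₁ e₀≡g = ≡.sym e₀≡g , λ w≈0 → y₀≉0 (trans (sym (*-identityˡ (y e₀))) w≈0)
        ... | g , xg≉0 , inj₂ g≡∁e₀ = contradiction (g , e₀ , xg≉0 y₀≉0 , x₀≉0 , g≡∁e₀) ¬cx
      y′₀≉0 : ¬ y′ e₀ ≈ 0#
      y′₀≉0 y′≈0 = proj₂ (proj₂ w₀≉0) (push-nonNeg-≈0 φ w e₀ w-nonNeg₀ y′≈0 (proj₁ w₀≉0) (proj₁ (proj₂ w₀≉0)))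
      s≉0 : ¬ s ≈ 0#
      s≉0 s≈0 = y′₀≉0 (trans (y′≈sx e₀) (trans (*-congʳ s≈0) (zeroˡ (x e₀))))
      0≤s : 0# ≤ s
      0≤s with ≤.total 0# s
      ... | inj₁ 0≤s = 0≤s
      ... | inj₂ s≤0 = contradiction (≤.antisym y′≤0 (push-nonNeg φ w e₀ w-nonNeg₀)) y′₀≉0
        where
        y′≤0 : y′ e₀ ≤ 0#
        y′≤0 = ≤-resp (trans (-‿cong (sym (-‿distribˡ-* s (x e₀)))) (trans (-‿involutive _) (sym (y′≈sx e₀)))) refl
                 (0≤x⇒-x≤0 (*-nonNeg (x≤0⇒0≤-x s≤0) (0≤x e₀)))

      -- Outside the support of y only complemented edges can contribute, and they do so negatively.
      -- As s x is nonnegative, x vanishes there too.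
      w-nonPos : ∀ {e} → y e ≈ 0# → ∀ f → φ f ≡ e → w f ≤ 0#
      w-nonPos y≈0 f eq with partner f
      w-nonPos y≈0 f ≡.refl | g , _ , inj₁ ≡.refl = ≤.reflexive (trans (*-congˡ y≈0) (zeroʳ _))
      w-nonPos y≈0 f eq     | g , _ , inj₂ _      = ≤-resp (sym (-1*x≈-x (y f))) refl (0≤x⇒-x≤0 (0≤y f))
      x⊆y : x ⊆ₛ y
      x⊆y e y≈0 = *-≈0⇒≈0 s≉0 (≤.antisym
        (≤-resp (y′≈sx e) refl (push-nonPos φ w e (w-nonPos y≈0)))
        (*-nonNeg 0≤s (0≤x e)))

    -- The common edge separates a support from its family of complements: on three points {1}, {2},
    -- {3} and {2,3}, {1,3}, {1,2} meet the same pairs.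
    same-pairs-unique : ∀ {x y} → vert (Pfpm H) x → vert (Pfpm H) y → Covered x y → Covered y x →
                        (∃ λ e → ¬ x e ≈ 0# × ¬ y e ≈ 0#) → x ≋ y
    same-pairs-unique {x} {y} vx vy x⊆y y⊆x common with em {HasComplements x} | em {HasComplements y}
    ... | yes cx | _      = complements-unique vx (proj₁ vy) cx y⊆x
    ... | no  _  | yes cy = λ e → sym (complements-unique vy (proj₁ vx) cy x⊆y e)
    ... | no ¬cx | no ¬cy = covered-unique vx vy ¬cx ¬cy y⊆x common

    -- Supports as minimal balanced collections

    supportBijection : ∀ (x : Vector Carrier m) → ∃ λ k → HasCardinality (setoid (Fin m)) (λ e → ¬ x e ≈ 0#) k
    supportBijection x =
      let k , bij , _ = enumerate em (setoid (Fin m)) (λ e → ¬ x e ≈ 0#) _≡_ (allFin m)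
                          (λ e _ → e , ∈-allFin e , ≡.refl) (λ { _ _ _ _ _ ≡.refl ≡.refl → ≡.refl })
      in k , bij

    module Support (x : Vector Carrier m) where
      open Bijection (proj₂ (supportBijection x)) using (to; strictlySurjective)
        renaming (injective to to-injective)

      edge : Fin (proj₁ (supportBijection x)) → Fin m
      edge j = proj₁ (to j)

      edge≉0 : ∀ j → ¬ x (edge j) ≈ 0#
      edge≉0 j = proj₂ (to j)

      edge-surjective : ∀ e → ¬ x e ≈ 0# → ∃ λ j → edge j ≡ e
      edge-surjective e x≉0 = strictlySurjective (e , x≉0)

      support : Collection n
      support = record
        { size      = proj₁ (supportBijection x)
        ; member    = λ j → member H (edge j)
        ; injective = λ eq → to-injective (injective H eq)
        }

      -- The nonzero entries of x are balancing weights. The weights of a balanced subcollection,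
      -- pushed to the edges, give a feasible point supported in the support of x; it equals x by
      -- `vertex-unique`, so the subcollection is everything.
      support-minimal : vert (Pfpm H) x → MinimalBalanced support
      support-minimal vx@((0≤x , Ax≈1) , _) = balanced , minimal
        where
        balanced : Balanced support
        balanced = (λ j → x (edge j)) , (λ j → 0≤x (edge j) , edge≉0 j ∘ sym) , λ i → begin
          sum (λ j → x (edge j) * A i (edge j))          ≈⟨ sum-cong-≋ (λ j → *-comm (x (edge j)) _) ⟩
          sum (λ j → A i (edge j) * x (edge j))          ≈⟨ sum-push (A i) edge (λ j → x (edge j)) ⟨
          sum (λ e → A i e * push edge (x ∘ edge) e)     ≈⟨ sum-cong-≋ (λ e → *-congˡ (push-x e)) ⟩
          (A · x) i                                      ≈⟨ Ax≈1 i ⟩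
          1#                                             ∎
          where
          push-x : ∀ e → push edge (x ∘ edge) e ≈ x e
          push-x e with em {x e ≈ 0#}
          ... | yes x≈0 = trans (push-≈0 edge _ e λ { j ≡.refl → x≈0 }) (sym x≈0)
          ... | no  x≉0 with edge-surjective e x≉0
          ...   | j , ≡.refl = push-injective edge (x ∘ edge) to-injective j
        minimal : ∀ Ψ → Ψ ⊂ support → ¬ Balanced Ψ
        minimal Ψ (Ψ⊆ , ⊈Ψ) (w , 0<w , Aw≈1) = ⊈Ψ support⊆Ψ
          where
          g : Fin (size Ψ) → Fin m
          g j = edge (proj₁ (Ψ⊆ (member Ψ j) (j , ≡.refl)))
          member-g : ∀ j → member H (g j) ≡ member Ψ j
          member-g j = proj₂ (Ψ⊆ (member Ψ j) (j , ≡.refl))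
          x≋y : x ≋ push g w
          x≋y = vertex-unique vx
            (push-Pfpm g w (proj₁ ∘ 0<w) λ i →
              trans (sum-cong-≋ λ j → trans (*-congʳ (reflexive (≡.cong (λ S → 𝟙 S i) (member-g j)))) (*-comm _ _)) (Aw≈1 i))
            (λ e x≈0 → push-≈0 g w e λ { j ≡.refl → contradiction x≈0 (edge≉0 _) })
          support⊆Ψ : support ⊆ Ψ
          support⊆Ψ S (l , ≡.refl) = stable em λ S∉Ψ →
            edge≉0 l (trans (x≋y (edge l)) (push-≈0 g w (edge l) λ j gj≡e →
              contradiction (j , ≡.trans (≡.sym (member-g j)) (≡.cong (member H) gj≡e)) S∉Ψ))

    open Support public using (support; support-minimal)

    support-determines : ∀ {x y} → vert (Pfpm H) x → vert (Pfpm H) y → support y ⊆ support x → x ≋ y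
    support-determines {x} {y} vx vy y⊆x = vertex-unique vx (proj₁ vy) λ e x≈0 → stable em λ y≉0 →
      let j , edge≡e = Support.edge-surjective y e y≉0
          l , eq     = y⊆x (member H e) (j , ≡.cong (member H) edge≡e)
      in Support.edge≉0 x l (trans (reflexive (≡.cong x (injective H eq))) x≈0)

    -- A vertex is coded by the index of its support among the minimal balanced collections.
    vertices≤minimalBalanced : ∀ {b} → B[ n ]≡ b → ∃ λ v → ∣vertPfpm H ∣≡ v × v ℕ.≤ b
    vertices≤minimalBalanced {b} bij =
      let v , bij′ , v≤ = enumerate em (pointSetoid m) (vert (Pfpm H)) (λ x i → proj₁ (to i) ≅ support x) (allFin b)
            (λ x vx → let i , eq = strictlySurjective (support x , support-minimal x vx) in i , ∈-allFin i , eq)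
            (λ x y i vx vy i~x i~y → support-determines vx vy λ S → proj₁ i~x S ∘ proj₂ i~y S)
      in v , bij′ , ℕ.≤-trans v≤ (ℕ.≤-reflexive (length-tabulate (λ i → i)))
      where open Bijection bij using (to; strictlySurjective)

open import Data.Nat using (zero; suc; _≤_; _+_; _*_; _∸_; _^_; _!; NonZero; z≤n; s≤s)
open import Data.Nat.Combinatorics using (_C_; nCk+nC[k+1]≡[n+1]C[k+1]; k>n⇒nCk≡0)
open import Data.Nat.Properties hiding (_≟_)
open import Data.Nat.Tactic.RingSolver using (solve-∀)
open ≡ using (refl; sym; trans; cong; cong₂; subst; subst₂; module ≡-Reasoning)

-- Sublists of bounded length and their number

module _ {A : Set} where

  -- Sublists keep the order of the list, so a set of entries cut out by `filter` is found here
  -- literally.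
  choose≤ : ℕ → List A → List (List A)
  choose≤ k       []      = [ [] ]
  choose≤ zero    (a ∷ L) = [ [] ]
  choose≤ (suc k) (a ∷ L) = map (a ∷_) (choose≤ k L) ++ choose≤ (suc k) L

  filter∈choose≤ : ∀ {P : Pred A 0ℓ} (P? : Decidable P) k L →
                   length (filter P? L) ≤ k → filter P? L ∈ choose≤ k L
  filter∈choose≤ P? k []      _ = here refl
  filter∈choose≤ P? k (a ∷ L) h with does (P? a)
  filter∈choose≤ P? (suc k) (a ∷ L) (s≤s h) | true =
    ∈-++⁺ˡ (∈-map⁺ (a ∷_) (filter∈choose≤ P? k L h))
  filter∈choose≤ P? (suc k) (a ∷ L) h | false =
    ∈-++⁺ʳ (map (a ∷_) (choose≤ k L)) (filter∈choose≤ P? (suc k) L h)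
  filter∈choose≤ P? zero (a ∷ L) h | false with filter P? L
  filter∈choose≤ P? zero (a ∷ L) z≤n | false | [] = here refl

  length-choose≤-0 : ∀ L → length (choose≤ 0 L) ≡ 1
  length-choose≤-0 []      = refl
  length-choose≤-0 (a ∷ L) = refl

  length-choose≤-∷ : ∀ k a L → length (choose≤ (suc k) (a ∷ L)) ≡
                     length (choose≤ k L) + length (choose≤ (suc k) L)
  length-choose≤-∷ k a L =
    trans (length-++ (map (a ∷_) (choose≤ k L)))
          (cong (_+ length (choose≤ (suc k) L)) (length-map (a ∷_) (choose≤ k L)))

  -- Both sides obey Pascal's rule in `L`; the length is thus a partial sum of binomial
  -- coefficients.
  length-choose≤-suc : ∀ k L → length (choose≤ (suc k) L) ≡
                       length (choose≤ k L) + (length L C suc k)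
  length-choose≤-suc k [] = sym (cong suc (k>n⇒nCk≡0 (s≤s (z≤n {k}))))
  length-choose≤-suc zero (a ∷ L) = begin
    length (choose≤ 1 (a ∷ L))                     ≡⟨ length-choose≤-∷ 0 a L ⟩
    length (choose≤ 0 L) + length (choose≤ 1 L)    ≡⟨ cong₂ _+_ (length-choose≤-0 L) (length-choose≤-suc 0 L) ⟩
    1 + (length (choose≤ 0 L) + (length L C 1))    ≡⟨ cong (λ z → 1 + (z + (length L C 1))) (length-choose≤-0 L) ⟩
    1 + ((length L C 0) + (length L C 1))          ≡⟨ cong suc (nCk+nC[k+1]≡[n+1]C[k+1] (length L) 0) ⟩
    1 + (suc (length L) C 1)                       ∎
    where open ≡-Reasoning
  length-choose≤-suc (suc k) (a ∷ L) = begin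
    length (choose≤ (2 + k) (a ∷ L))
      ≡⟨ length-choose≤-∷ (suc k) a L ⟩
    length (choose≤ (1 + k) L) + length (choose≤ (2 + k) L)
      ≡⟨ cong₂ _+_ (length-choose≤-suc k L) (length-choose≤-suc (suc k) L) ⟩
    (u + (M C suc k)) + (v + (M C (2 + k)))
      ≡⟨ interchange u (M C suc k) v (M C (2 + k)) ⟩
    (u + v) + ((M C suc k) + (M C (2 + k)))
      ≡⟨ cong₂ _+_ (sym (length-choose≤-∷ k a L)) (nCk+nC[k+1]≡[n+1]C[k+1] M (suc k)) ⟩
    length (choose≤ (suc k) (a ∷ L)) + (suc M C (2 + k)) ∎
    where
    open ≡-Reasoning
    M = length L
    u = length (choose≤ k L)
    v = length (choose≤ (suc k) L)
    interchange : ∀ a b c d → (a + b) + (c + d) ≡ (a + c) + (b + d)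
    interchange = solve-∀

lookup-injective : ∀ {A : Set} {xs : List A} → Unique xs →
                   ∀ i j → lookup xs i ≡ lookup xs j → i ≡ j
lookup-injective (x∉ AllPairs.∷ _)  zero    zero    _  = refl
lookup-injective (x∉ AllPairs.∷ _)  zero    (suc j) eq = contradiction eq (All.lookup x∉ (∈-lookup j))
lookup-injective (x∉ AllPairs.∷ _)  (suc i) zero    eq = contradiction (sym eq) (All.lookup x∉ (∈-lookup i))
lookup-injective (_  AllPairs.∷ xs!) (suc i) (suc j) eq = cong suc (lookup-injective xs! i j eq)

-- These are the top two terms of the binomial expansion of the right side.
bernoulli : ∀ M k → suc k * M ^ k + M ^ suc k ≤ suc M ^ suc k
bernoulli M zero    = ≤-reflexive (lemma M)
  where
  lemma : ∀ M → 1 * 1 + M * 1 ≡ suc M * 1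
  lemma = solve-∀
bernoulli M (suc k) = begin
  suc (suc k) * (M * p) + M * (M * p)              ≤⟨ m≤m+n _ (suc k * p) ⟩
  suc (suc k) * (M * p) + M * (M * p) + suc k * p  ≡⟨ lemma M k p ⟩
  suc M * (suc k * p + M * p)                      ≤⟨ *-monoʳ-≤ (suc M) (bernoulli M k) ⟩
  suc M ^ suc (suc k)                              ∎
  where
  open ≤-Reasoning
  p = M ^ k
  lemma : ∀ M k p → suc (suc k) * (M * p) + M * (M * p) + suc k * p ≡ suc M * (suc k * p + M * p)
  lemma = solve-∀

-- The left side is a falling factorial. Pascal's rule splits it into two terms, which induction
-- bounds by those of `bernoulli`.
k!*nCk≤n^k : ∀ n k → k ! * (n C k) ≤ n ^ k
k!*nCk≤n^k n       zero    = ≤-refl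
k!*nCk≤n^k zero    (suc k) = ≤-reflexive (trans (cong (suc k ! *_) (k>n⇒nCk≡0 (s≤s (z≤n {k})))) (*-zeroʳ (suc k !)))
k!*nCk≤n^k (suc n) (suc k) = begin
  suc k ! * (suc n C suc k)                              ≡⟨ cong (suc k ! *_) (sym (nCk+nC[k+1]≡[n+1]C[k+1] n k)) ⟩
  suc k ! * ((n C k) + (n C suc k))                      ≡⟨ *-distribˡ-+ (suc k !) (n C k) (n C suc k) ⟩
  suc k * k ! * (n C k) + suc k ! * (n C suc k)          ≡⟨ cong (_+ suc k ! * (n C suc k)) (*-assoc (suc k) (k !) (n C k)) ⟩
  suc k * (k ! * (n C k)) + suc k ! * (n C suc k)        ≤⟨ +-mono-≤ (*-monoʳ-≤ (suc k) (k!*nCk≤n^k n k)) (k!*nCk≤n^k n (suc k)) ⟩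
  suc k * n ^ k + n ^ suc k                              ≤⟨ bernoulli n k ⟩
  suc n ^ suc k                                          ∎
  where open ≤-Reasoning

-- For k at most half of M the last binomial dominates: k ! times the sum of the earlier ones is at
-- most k * 2 M^(k-1), hence at most M^k, and the last one adds at most M^k more.
k!*length-choose≤ : ∀ {A : Set} k (L : List A) → 2 * k ≤ length L →
                    k ! * length (choose≤ k L) ≤ 2 * length L ^ k
k!*length-choose≤ zero L _ = begin
  1 * length (choose≤ 0 L)  ≡⟨ cong (1 *_) (length-choose≤-0 L) ⟩
  1                         ≤⟨ s≤s z≤n ⟩
  2                         ∎
  where open ≤-Reasoning
k!*length-choose≤ (suc k) L h = begin
  suc k ! * length (choose≤ (suc k) L)               ≡⟨ cong (suc k ! *_) (length-choose≤-suc k L) ⟩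
  suc k * k ! * (l + (M C suc k))                    ≡⟨ *-distribˡ-+ (suc k * k !) l (M C suc k) ⟩
  suc k * k ! * l + suc k ! * (M C suc k)            ≡⟨ cong (_+ suc k ! * (M C suc k)) (*-assoc (suc k) (k !) l) ⟩
  suc k * (k ! * l) + suc k ! * (M C suc k)          ≤⟨ +-mono-≤ (*-monoʳ-≤ (suc k) (k!*length-choose≤ k L 2k≤M)) (k!*nCk≤n^k M (suc k)) ⟩
  suc k * (2 * M ^ k) + M ^ suc k                    ≡⟨ cong (_+ M ^ suc k) (lemma (suc k) (M ^ k)) ⟩
  2 * suc k * M ^ k + M ^ suc k                      ≤⟨ +-monoˡ-≤ (M ^ suc k) (*-monoˡ-≤ (M ^ k) h) ⟩
  M * M ^ k + M ^ suc k                              ≡⟨ cong (λ z → M * M ^ k + z) (sym (+-identityʳ (M ^ suc k))) ⟩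
  2 * M ^ suc k                                      ∎
  where
  open ≤-Reasoning
  M = length L
  l = length (choose≤ k L)
  2k≤M : 2 * k ≤ M
  2k≤M = ≤-trans (*-monoʳ-≤ 2 (n≤1+n k)) h
  lemma : ∀ k p → k * (2 * p) ≡ 2 * k * p
  lemma = solve-∀

-- Subsets of [n] and numerical bounds

allSubsets : ∀ n → List (Subset n)
allSubsets zero    = [ [] ]
allSubsets (suc n) = map (inside ∷_) (allSubsets n) ++ map (outside ∷_) (allSubsets n)

∈-allSubsets : ∀ {n} (S : Subset n) → S ∈ allSubsets n
∈-allSubsets []            = here refl
∈-allSubsets (inside  ∷ S) = ∈-++⁺ˡ (∈-map⁺ (inside ∷_) (∈-allSubsets S))
∈-allSubsets (outside ∷ S) = ∈-++⁺ʳ (map (inside ∷_) (allSubsets _)) (∈-map⁺ (outside ∷_) (∈-allSubsets S))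

length-allSubsets : ∀ n → length (allSubsets n) ≡ 2 ^ n
length-allSubsets zero    = refl
length-allSubsets (suc n) = begin
  length (map (inside ∷_) (allSubsets n) ++ map (outside ∷_) (allSubsets n))
    ≡⟨ length-++ (map (inside ∷_) (allSubsets n)) ⟩
  length (map (inside ∷_) (allSubsets n)) + length (map (outside ∷_) (allSubsets n))
    ≡⟨ cong₂ _+_ (length-map _ (allSubsets n)) (length-map _ (allSubsets n)) ⟩
  length (allSubsets n) + length (allSubsets n)
    ≡⟨ cong₂ _+_ (length-allSubsets n) (trans (length-allSubsets n) (sym (+-identityʳ (2 ^ n)))) ⟩
  2 ^ suc n ∎
  where open ≡-Reasoning

allSubsets-unique : ∀ n → Unique (allSubsets n)
allSubsets-unique zero    = [] AllPairs.∷ AllPairs.[]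
allSubsets-unique (suc n) =
  Unique.++⁺ (Unique.map⁺ ∷-injectiveʳ (allSubsets-unique n))
             (Unique.map⁺ ∷-injectiveʳ (allSubsets-unique n)) disjoint
  where
  disjoint : ∀ {S} → ¬ (S ∈ map (inside ∷_) (allSubsets n) × S ∈ map (outside ∷_) (allSubsets n))
  disjoint (p , q) with ∈-map⁻ (inside ∷_) p | ∈-map⁻ (outside ∷_) q
  ... | _ , _ , refl | _ , _ , ()

-- This is the hypothesis of `k!*length-choose≤` for n = m + 1 and 2^m pairs. Equality holds at m =
-- 3, where the induction starts.
2*[1+m]≤2^m : ∀ m → 3 ≤ m → 2 * suc m ≤ 2 ^ m
2*[1+m]≤2^m m 3≤m = subst (λ m → 2 * suc m ≤ 2 ^ m) (m+[n∸m]≡n 3≤m) (go (m ∸ 3))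
  where
  go : ∀ j → 2 * suc (3 + j) ≤ 2 ^ (3 + j)
  go zero    = ≤-refl
  go (suc j) = begin
    2 * suc (3 + suc j)           ≤⟨ m≤m+n _ (2 * (3 + j)) ⟩
    2 * suc (3 + suc j) + 2 * (3 + j) ≡⟨ lemma j ⟩
    2 * (2 * suc (3 + j))         ≤⟨ *-monoʳ-≤ 2 (go j) ⟩
    2 ^ (3 + suc j)               ∎
    where
    open ≤-Reasoning
    lemma : ∀ j → 2 * suc (3 + suc j) + 2 * (3 + j) ≡ 2 * (2 * suc (3 + j))
    lemma = solve-∀

-- Unnormalised fractions are compared by cross multiplication, so the claim is moved there.
n!*v≤c*a⇒v≤c*a/n! : ∀ v c a n → n ! * v ≤ c * a → (+ v ℚ./ 1) ℚ.≤ (+ c ℚ./ 1) ℚ.* (a / n !)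
n!*v≤c*a⇒v≤c*a/n! v c a n h = ℚ.toℚᵘ-cancel-≤ (begin
  ℚ.toℚᵘ (+ v ℚ./ 1)                      ≃⟨ ℚ.toℚᵘ-fromℚᵘ (+ v ℚᵘ./ 1) ⟩
  + v ℚᵘ./ 1                              ≤⟨ lemma (n !) {{n !≢0}} h ⟩
  (+ c ℚᵘ./ 1) ℚᵘ.* ((+ a ℚᵘ./ (n !)) {{n !≢0}})
    ≃⟨ ℚᵘ.*-cong (ℚ.toℚᵘ-fromℚᵘ (+ c ℚᵘ./ 1)) (to-/ (n !) {{n !≢0}}) ⟨
  ℚ.toℚᵘ (+ c ℚ./ 1) ℚᵘ.* ℚ.toℚᵘ (a / n !)  ≃⟨ ℚ.toℚᵘ-homo-* (+ c ℚ./ 1) (a / n !) ⟨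
  ℚ.toℚᵘ ((+ c ℚ./ 1) ℚ.* (a / n !))      ∎)
  where
  open ℚᵘ.≤-Reasoning
  to-/ : ∀ d .{{_ : NonZero d}} → ℚ.toℚᵘ (+ a ℚ./ d) ℚᵘ.≃ (+ a ℚᵘ./ d)
  to-/ (suc d) = ℚ.toℚᵘ-fromℚᵘ (+ a ℚᵘ./ suc d)
  lemma : ∀ d .{{_ : NonZero d}} → d * v ≤ c * a → (+ v ℚᵘ./ 1) ℚᵘ.≤ (+ c ℚᵘ./ 1) ℚᵘ.* (+ a ℚᵘ./ d)
  lemma (suc d) h = ℚᵘ.*≤* (subst₂ ℤ._≤_
    (trans (cong (λ z → + z) (trans (*-comm (suc d) v) (cong (v *_) (sym (+-identityʳ (suc d)))))) (ℤ.pos-* v (suc (d + 0))))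
    (trans (ℤ.pos-* c a) (sym (ℤ.*-identityʳ (+ c ℤ.* + a)))) (ℤ.+≤+ h))

-- Sign bits, constants and complement pairs

module _ {A : Set} where

  tag : Bool → A → Bool × A
  tag b a = b , a

  signed : List A → List (Bool × A)
  signed L = map (tag inside) L ++ map (tag outside) L

  ∈-signed : ∀ b {a L} → a ∈ L → (b , a) ∈ signed L
  ∈-signed inside      a∈L = ∈-++⁺ˡ (∈-map⁺ (tag inside) a∈L)
  ∈-signed outside {L = L} a∈L = ∈-++⁺ʳ (map (tag inside) L) (∈-map⁺ (tag outside) a∈L)

  length-signed : ∀ L → length (signed L) ≡ 2 * length L
  length-signed L = trans (length-++ (map (tag inside) L))
    (cong₂ _+_ (length-map (tag inside) L)
               (trans (length-map (tag outside) L) (sym (+-identityʳ (length L)))))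

-- The constant 4 is the 2 for the bit of a code times the 2 of `k!*length-choose≤`.
a*v≤4*b : ∀ a v l b → v ≤ 2 * l → a * l ≤ 2 * b → a * v ≤ 4 * b
a*v≤4*b a v l b v≤2l al≤2b = begin
  a * v        ≤⟨ *-monoʳ-≤ a v≤2l ⟩
  a * (2 * l)  ≡⟨ swap a l ⟩
  2 * (a * l)  ≤⟨ *-monoʳ-≤ 2 al≤2b ⟩
  2 * (2 * b)  ≡⟨ *-assoc 2 2 b ⟨
  4 * b        ∎
  where
  open ≤-Reasoning
  swap : ∀ a l → a * (2 * l) ≡ 2 * (a * l)
  swap = solve-∀

2^m^[1+m] : ∀ m → (2 ^ m) ^ suc m ≡ 2 ^ (suc m * suc m ∸ suc m)
2^m^[1+m] m = trans (^-*-assoc 2 m (suc m)) (cong (2 ^_) (sym (m+n∸m≡n (suc m) (m * suc m))))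

-- The pair {S , ∁ S} is represented by its member avoiding 0, restricted to the other points.
rep : ∀ {m} → Subset (suc m) → Subset m
rep (inside  ∷ S) = ∁ S
rep (outside ∷ S) = S

unrep : ∀ {m} → Bool → Subset m → Subset (suc m)
unrep inside  r = inside  ∷ ∁ r
unrep outside r = outside ∷ r

unrep-rep : ∀ {m} (S : Subset (suc m)) → unrep (head S) (rep S) ≡ S
unrep-rep (inside  ∷ S) = cong (inside ∷_) (∁-involutive S)
unrep-rep (outside ∷ S) = refl

rep-≡ : ∀ {m} (S T : Subset (suc m)) → rep S ≡ rep T → S ≡ T ⊎ T ≡ ∁ S
rep-≡ (inside  ∷ S) (inside  ∷ T) eq =
  inj₁ (cong (inside ∷_) (trans (sym (∁-involutive S)) (trans (cong ∁ eq) (∁-involutive T))))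
rep-≡ (inside  ∷ S) (outside ∷ T) eq = inj₂ (cong (outside ∷_) (sym eq))
rep-≡ (outside ∷ S) (inside  ∷ T) eq =
  inj₂ (cong (inside ∷_) (trans (sym (∁-involutive T)) (cong ∁ (sym eq))))
rep-≡ (outside ∷ S) (outside ∷ T) eq = inj₁ (cong (outside ∷_) eq)

-- Finiteness of the number of minimal balanced collections

minimalBalanced-finite : (em : ExcludedMiddle 0ℓ) (ℝ : RealNumbers) →
                         ∀ n → ∃ λ b → Over.B[_]≡_ ℝ n b
minimalBalanced-finite em ℝ n =
  let b , bij , _ = enumerate em (collectionSetoid n) MinimalBalanced Lists
                      -- With the full length as bound, these are all sublists.
                      (choose≤ (length (allSubsets n)) (allSubsets n)) total
                      (λ Φ Ψ c _ _ Φ~c Ψ~c → (λ S → proj₂ (Ψ~c S) ∘ proj₁ (Φ~c S)) ,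
                                             (λ S → proj₂ (Φ~c S) ∘ proj₁ (Ψ~c S)))
  in b , bij
  where
  open Over ℝ
  Lists : Collection n → List (Subset n) → Set
  Lists Φ c = ∀ S → (S ∈ᶜ Φ → S ∈ c) × (S ∈ c → S ∈ᶜ Φ)
  total : ∀ Φ → MinimalBalanced Φ → ∃ λ c → c ∈ choose≤ (length (allSubsets n)) (allSubsets n) × Lists Φ c
  total Φ _ =
    filter Φ? (allSubsets n) ,
    filter∈choose≤ Φ? _ (allSubsets n) (length-filter Φ? (allSubsets n)) ,
    λ S → ∈-filter⁺ Φ? (∈-allSubsets S) , proj₂ ∘ ∈-filter⁻ Φ? {xs = allSubsets n}
    where
    Φ? : Decidable (_∈ᶜ Φ)
    Φ? S = em

-- Coding vertices by a bit and a list of pairs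

module _ (em : ExcludedMiddle 0ℓ) (ℝ : RealNumbers) {m} (H : Hypergraph (suc m)) where
  open RealNumbers ℝ using (Carrier; 0#; _≈_)
  open Over ℝ
  open FractionalMatchings em ℝ

  codes : List (Bool × List (Subset m))
  codes = signed (choose≤ (suc m) (allSubsets m))

  IsRep : Vector Carrier (size H) → Subset m → Set
  IsRep x S = ∃ λ e → ¬ x e ≈ 0# × rep (member H e) ≡ S

  -- c lists the pairs {S , ∁ S} met by the support, and b tells which member of the first
  -- pair occurs.
  Encodes : Vector Carrier (size H) → Bool × List (Subset m) → Set
  Encodes x (b , c) =
    (∀ S → S ∈ c → IsRep x S) ×
    (∀ e → ¬ x e ≈ 0# → rep (member H e) ∈ c) ×
    (∃ λ r → ∃ λ c′ → c ≡ r ∷ c′ × (∃ λ e → ¬ x e ≈ 0# × member H e ≡ unrep b r))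

  encode : ∀ x → vert (Pfpm H) x → ∃ λ c → c ∈ codes × Encodes x c
  encode x vx = (b , reps) , ∈-signed b (filter∈choose≤ IsRep? (suc m) (allSubsets m) length-reps) ,
                reps⇒IsRep , (λ e x≉0 → IsRep⇒reps (e , x≉0 , refl)) , (r , c′ , reps≡ , e , x≉0 , e≡)
    where
    IsRep? : Decidable (IsRep x)
    IsRep? S = em
    reps : List (Subset m)
    reps = filter IsRep? (allSubsets m)
    reps⇒IsRep : ∀ S → S ∈ reps → IsRep x S
    reps⇒IsRep S S∈ = proj₂ (∈-filter⁻ IsRep? {xs = allSubsets m} S∈)
    IsRep⇒reps : ∀ {S} → IsRep x S → S ∈ reps
    IsRep⇒reps {S} = ∈-filter⁺ IsRep? (∈-allSubsets S)
    edgeOf : ∀ j → IsRep x (lookup reps j)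
    edgeOf j = reps⇒IsRep _ (∈-lookup j)
    -- One edge of the support is chosen for each listed pair. Distinct pairs have distinct edges,
    -- so there are at most n of them.
    length-reps : length reps ≤ suc m
    length-reps = supported-injective⇒≤ H vx (proj₁ ∘ edgeOf)
      (λ {j} {l} eq → lookup-injective (Unique.filter⁺ IsRep? (allSubsets-unique m)) j l
        (trans (sym (proj₂ (proj₂ (edgeOf j)))) (trans (cong (rep ∘ member H) eq) (proj₂ (proj₂ (edgeOf l))))))
      (λ j → proj₁ (proj₂ (edgeOf j)))
    -- The bit refers to the first pair, which exists because the support is nonempty.
    first : ∃ λ r → ∃ λ c′ → reps ≡ r ∷ c′
    first with nonempty-support H zero (proj₁ vx)
    ... | e , x≉0 with reps | IsRep⇒reps (e , x≉0 , refl)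
    ...   | r ∷ c′ | _ = r , c′ , refl
    r = proj₁ first
    c′ = proj₁ (proj₂ first)
    reps≡ = proj₂ (proj₂ first)
    r∈ : IsRep x r
    r∈ = reps⇒IsRep r (subst (r ∈_) (sym reps≡) (here refl))
    e = proj₁ r∈
    x≉0 = proj₁ (proj₂ r∈)
    b : Bool
    b = head (member H e)
    e≡ : member H e ≡ unrep b r
    e≡ = trans (sym (unrep-rep (member H e))) (cong (unrep b) (proj₂ (proj₂ r∈)))

  Encodes-covered : ∀ {x y c} → Encodes x c → Encodes y c → Covered H x y
  Encodes-covered (_ , x⊆c , _) (c⊆y , _) e x≉0 with c⊆y _ (x⊆c e x≉0)
  ... | f , y≉0 , eq with rep-≡ (member H e) (member H f) (sym eq)
  ...   | inj₁ e≡f  = f , y≉0 , inj₁ (injective H e≡f)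
  ...   | inj₂ f≡∁e = f , y≉0 , inj₂ f≡∁e

  Encodes-unique : ∀ x y c → vert (Pfpm H) x → vert (Pfpm H) y → Encodes x c → Encodes y c → x ≋ y
  Encodes-unique x y c vx vy x~c@(_ , _ , r , _ , refl , e , x≉0 , e≡) y~c@(_ , _ , _ , _ , refl , f , y≉0 , f≡) =
    same-pairs-unique H vx vy (Encodes-covered x~c y~c) (Encodes-covered y~c x~c)
      -- Equal codes share the first pair and the bit, so both witnessing edges are `unrep b r`:
      -- this is the common edge.
      (e , x≉0 , subst (λ e → ¬ y e ≈ 0#) (injective H (trans f≡ (sym e≡))) y≉0)

  n!*vertices≤ : 3 ≤ m → ∃ λ v → ∣vertPfpm H ∣≡ v × suc m ! * v ≤ 4 * 2 ^ (suc m * suc m ∸ suc m)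
  n!*vertices≤ 3≤m =
    let v , bij , v≤ = enumerate em (pointSetoid (size H)) (vert (Pfpm H)) Encodes codes encode Encodes-unique
    in v , bij , subst (λ k → suc m ! * v ≤ 4 * k) (2^m^[1+m] m)
         (a*v≤4*b (suc m !) v (length chosen) ((2 ^ m) ^ suc m) (≤-trans v≤ (≤-reflexive (length-signed chosen)))
           (subst (λ M → suc m ! * length chosen ≤ 2 * M ^ suc m) (length-allSubsets m)
             (k!*length-choose≤ (suc m) (allSubsets m)
               (≤-trans (2*[1+m]≤2^m m 3≤m) (≤-reflexive (sym (length-allSubsets m)))))))
    where chosen = choose≤ (suc m) (allSubsets m)

lemmaC1 : ExcludedMiddle 0ℓ → (ℝ : RealNumbers) → let open Over ℝ in
    (∀ (n : ℕ) → 1 ≤ n → (H : Hypergraph n) → NonemptyEdges H →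
    ∃[ v ] ∃[ b ] (∣vertPfpm H ∣≡ v) × (B[ n ]≡ b) × v ≤ b)
    ×
    (Σ[ C ∈ ℚ ] Σ[ n₀ ∈ ℕ ] (∀ (n : ℕ) → 1 ≤ n → n₀ ≤ n → (H : Hypergraph n) → NonemptyEdges H →
    ∃[ v ] (∣vertPfpm H ∣≡ v) × (+ v ℚ./ 1) ℚ.≤ C ℚ.* (2 ^ (n * n ∸ n) / n !)))
lemmaC1 em ℝ =
  (λ n _ H _ →
    let b , B≡b = minimalBalanced-finite em ℝ n
        v , V≡v , v≤b = FractionalMatchings.vertices≤minimalBalanced em ℝ H B≡b
    in v , b , V≡v , B≡b , v≤b) ,
  -- With n = m + 1, the threshold 4 for n is the bound 3 ≤ m of `2*[1+m]≤2^m`.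
  (+ 4 ℚ./ 1) , 4 , λ { (suc m) _ (s≤s 3≤m) H _ →
    let v , V≡v , bound = n!*vertices≤ em ℝ H 3≤m
    in v , V≡v , n!*v≤c*a⇒v≤c*a/n! v 4 (2 ^ (suc m * suc m ∸ suc m)) (suc m) bound }
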